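{- Let $\mathcal D$ be a non-trivial $G$-pairwise transitive $2$-design, where $G\le\mathrm{Aut}(\mathcal D)$. If $G$ has rank $2$ on blocks, then $\mathcal D$ is a symmetric design. If $G$ has rank $3$ on blocks, then $\mathcal D$ is a quasisymmetric design containing disjoint block pairs.
   Context: A design $\mathcal D=(\mathcal P,\mathcal B,\mathcal I)$ consists of finite sets $\mathcal P$ (points), $\mathcal B$ (blocks) and an incidence relation $\mathcal I\subseteq\mathcal P\times\mathcal B$. It is a $2$-$(v,k,\lambda)$ design (or $2$-design) if $|\mathcal P|=v$, each block is incident with exactly $k$ points, and each pair of distinct points is incident with exactly $\lambda$ common blocks. It is non-trivial if $2<k<v$; symmetric if $|\mathcal B|=v$; quasisymmetric if the number of points common to two distinct blocks takes exactly two values. An automorphism is a permutation of $\mathcal P\cup\mathcal B$ leaving $\mathcal P$ and $\mathcal B$ invariant setwise and preserving incidence; $\mathrm{Aut}(\mathcal D)$ is the group of all automorphisms. Two blocks are intersecting if some point is incident with both, and disjoint (non-intersecting) otherwise. For $G\le\mathrm{Aut}(\mathcal D)$, the $2$-design $\mathcal D$ is $G$-pairwise transitive if $G$ is transitive on each of the following five (possibly empty) sets of ordered pairs: pairs of distinct points, incident point-block pairs, non-incident point-block pairs, pairs of distinct intersecting blocks, pairs of non-intersecting blocks. A transitive permutation group has rank $n$ if a point stabiliser has exactly $n$ orbits. -}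

module Defs where

open import Level using (Level; 0ℓ; _⊔_; suc)
open import Algebra.Bundles using (Group)
open import Data.Nat.Base using (ℕ; _<_)
open import Data.Fin.Base using (Fin)
open import Data.Fin.Permutation
  using (Permutation′; _⟨$⟩ʳ_; id; flip; _∘ₚ_; inverseˡ; inverseʳ)
open import Data.Product.Base using (_×_; _,_; ∃; ∃₂)
open import Data.Sum.Base using (_⊎_)
open import Data.Vec.Base using (count; allFin)
open import Function.Bundles using (_⇔_; mk⇔; Equivalence; Inverse)
open import Relation.Binary.Bundles using (Setoid)
open import Relation.Binary.Core using (REL; Rel)
open import Relation.Binary.Definitions using (Decidable)
open import Relation.Binary.PropositionalEquality
  using (_≡_; _≢_; refl; sym; trans; cong; subst₂; setoid)
open import Relation.Nullary using (¬_)
open import Relation.Nullary.Decidable using (_×-dec_)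
open import Relation.Unary using (Pred; _∈_)

-- The point set is Fin v and the block set is Fin b.  Blocks are abstract
-- objects, so distinct blocks may be incident with the same points.
record Design (v b : ℕ) : Set₁ where
  field
    I  : REL (Fin v) (Fin b) 0ℓ
    I? : Decidable I

module _ {v b : ℕ} (D : Design v b) where
  open Design D

  record Is2Design (k λ′ : ℕ) : Set where
    field
      block-size : ∀ β → count (λ p → I? p β) (allFin v) ≡ k
      pair-count : ∀ {p q} → p ≢ q →
                   count (λ β → I? p β ×-dec I? q β) (allFin b) ≡ λ′

  Symmetric : Set
  Symmetric = b ≡ v

  common-points : Fin b → Fin b → ℕ
  common-points β γ = count (λ p → I? p β ×-dec I? p γ) (allFin v)

  Quasisymmetric : Set
  Quasisymmetric = ∃₂ λ x y →
    x ≢ y ×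
    (∃₂ λ β γ → β ≢ γ × common-points β γ ≡ x) ×
    (∃₂ λ β γ → β ≢ γ × common-points β γ ≡ y) ×
    (∀ {β γ} → β ≢ γ → common-points β γ ≡ x ⊎ common-points β γ ≡ y)

  Intersecting : Rel (Fin b) 0ℓ
  Intersecting β γ = ∃ λ p → I p β × I p γ

  Disjoint : Rel (Fin b) 0ℓ
  Disjoint β γ = ¬ Intersecting β γ

NonTrivial : (v k : ℕ) → Set
NonTrivial v k = 2 < k × k < v

-- A permutation of the disjoint union of points and blocks that leaves both
-- parts invariant is a pair consisting of a permutation of each.
record Automorphism {v b : ℕ} (D : Design v b) : Set where
  open Design D
  field
    onPoints  : Permutation′ v
    onBlocks  : Permutation′ b
    incidence : ∀ p β → I p β ⇔ I (onPoints ⟨$⟩ʳ p) (onBlocks ⟨$⟩ʳ β)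

open Automorphism public

-- Composition is that of functions: g ∙ h applies h first.
Aut : {v b : ℕ} → Design v b → Group 0ℓ 0ℓ
Aut {v} {b} D = record
  { Carrier = Automorphism D
  ; _≈_     = _≈_
  ; _∙_     = _∙_
  ; ε       = ε
  ; _⁻¹     = _⁻¹
  ; isGroup = record
    { isMonoid = record
      { isSemigroup = record
        { isMagma = record
          { isEquivalence = record
            { refl  = (λ _ → refl) , (λ _ → refl)
            ; sym   = λ (e , f) → (λ p → sym (e p)) , (λ β → sym (f β))
            ; trans = λ (e , f) (e′ , f′) →
                (λ p → trans (e p) (e′ p)) , (λ β → trans (f β) (f′ β))
            }
          ; ∙-cong = λ {g} {g′} {h} {h′} (e , f) (e′ , f′) →
              (λ p → trans (cong (onPoints g ⟨$⟩ʳ_) (e′ p)) (e _)) ,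
              (λ β → trans (cong (onBlocks g ⟨$⟩ʳ_) (f′ β)) (f _))
          }
        ; assoc = λ _ _ _ → (λ _ → refl) , (λ _ → refl)
        }
      ; identity = (λ _ → (λ _ → refl) , (λ _ → refl)) ,
                   (λ _ → (λ _ → refl) , (λ _ → refl))
      }
    ; inverse = (λ g → (λ _ → inverseˡ (onPoints g)) , (λ _ → inverseˡ (onBlocks g))) ,
                (λ g → (λ _ → inverseʳ (onPoints g)) , (λ _ → inverseʳ (onBlocks g)))
    ; ⁻¹-cong = λ {g} {h} (e , f) →
        ⁻¹-cong-perm (onPoints g) (onPoints h) e ,
        ⁻¹-cong-perm (onBlocks g) (onBlocks h) f
    }
  }
  where
  open Design D

  _≈_ : Rel (Automorphism D) 0ℓ
  g ≈ h = (∀ p → onPoints g ⟨$⟩ʳ p ≡ onPoints h ⟨$⟩ʳ p) ×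
          (∀ β → onBlocks g ⟨$⟩ʳ β ≡ onBlocks h ⟨$⟩ʳ β)

  _∙_ : Automorphism D → Automorphism D → Automorphism D
  g ∙ h = record
    { onPoints  = onPoints h ∘ₚ onPoints g
    ; onBlocks  = onBlocks h ∘ₚ onBlocks g
    ; incidence = λ p β → mk⇔
        (λ i → Equivalence.to (incidence g _ _) (Equivalence.to (incidence h p β) i))
        (λ i → Equivalence.from (incidence h p β) (Equivalence.from (incidence g _ _) i))
    }

  ε : Automorphism D
  ε = record
    { onPoints  = id
    ; onBlocks  = id
    ; incidence = λ _ _ → mk⇔ (λ i → i) (λ i → i)
    }

  _⁻¹ : Automorphism D → Automorphism D
  g ⁻¹ = record
    { onPoints  = flip (onPoints g)
    ; onBlocks  = flip (onBlocks g)
    ; incidence = λ p β → mk⇔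
        (λ i → Equivalence.from (incidence g _ _)
                 (subst₂ I (sym (inverseʳ (onPoints g))) (sym (inverseʳ (onBlocks g))) i))
        (λ i → subst₂ I (inverseʳ (onPoints g)) (inverseʳ (onBlocks g))
                 (Equivalence.to (incidence g _ _) i))
    }

  ⁻¹-cong-perm : ∀ {n} (π ρ : Permutation′ n) →
                 (∀ i → π ⟨$⟩ʳ i ≡ ρ ⟨$⟩ʳ i) →
                 ∀ i → flip π ⟨$⟩ʳ i ≡ flip ρ ⟨$⟩ʳ i
  ⁻¹-cong-perm π ρ e i =
    trans (cong (flip π ⟨$⟩ʳ_)
            (trans (sym (inverseʳ ρ)) (sym (e (flip ρ ⟨$⟩ʳ i)))))
          (inverseˡ π)

record Subgroup {c e : Level} (𝔾 : Group c e) (ℓ : Level) : Set (c ⊔ e ⊔ suc ℓ) where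
  open Group 𝔾
  field
    Member    : Pred Carrier ℓ
    resp-≈    : ∀ {g h} → g ≈ h → g ∈ Member → h ∈ Member
    ε-closed  : ε ∈ Member
    ∙-closed  : ∀ {g h} → g ∈ Member → h ∈ Member → (g ∙ h) ∈ Member
    ⁻¹-closed : ∀ {g} → g ∈ Member → (g ⁻¹) ∈ Member

open Subgroup public

module _ {v b : ℕ} {D : Design v b} {ℓ : Level} where

  blockStabiliser : Subgroup (Aut D) ℓ → Fin b → Subgroup (Aut D) ℓ
  blockStabiliser G β = record
    { Member    = λ g → g ∈ Member G × onBlocks g ⟨$⟩ʳ β ≡ β
    ; resp-≈    = λ (e , f) (m , s) → resp-≈ G (e , f) m , trans (sym (f β)) s
    ; ε-closed  = ε-closed G , refl
    ; ∙-closed  = λ {g} (m , s) (m′ , s′) →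
        ∙-closed G m m′ , trans (cong (onBlocks g ⟨$⟩ʳ_) s′) s
    ; ⁻¹-closed = λ {g} (m , s) →
        ⁻¹-closed G m , trans (cong (flip (onBlocks g) ⟨$⟩ʳ_) (sym s)) (inverseˡ (onBlocks g))
    }

  blockOrbits : Subgroup (Aut D) ℓ → Setoid 0ℓ ℓ
  blockOrbits G = record
    { Carrier       = Fin b
    ; _≈_           = λ β γ → ∃ λ g → g ∈ Member G × onBlocks g ⟨$⟩ʳ β ≡ γ
    ; isEquivalence = record
      { refl  = ε , ε-closed G , refl
      ; sym   = λ { (g , m , refl) → g ⁻¹ , ⁻¹-closed G m , inverseˡ (onBlocks g) }
      ; trans = λ { (g , m , refl) (h , m′ , refl) → h ∙ g , ∙-closed G m′ m , refl }
      }
    }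
    where open Group (Aut D) using (ε; _∙_; _⁻¹)

  HasBlockOrbits : Subgroup (Aut D) ℓ → ℕ → Set ℓ
  HasBlockOrbits H n = Inverse (blockOrbits H) (setoid (Fin n))

  TransitiveOnBlocks : Subgroup (Aut D) ℓ → Set ℓ
  TransitiveOnBlocks G = ∀ β γ → Setoid._≈_ (blockOrbits G) β γ

  -- By transitivity all block stabilisers are conjugate, so the choice of β
  -- is immaterial; asking for some β excludes the empty block set.
  BlockRank : Subgroup (Aut D) ℓ → ℕ → Set ℓ
  BlockRank G n =
    TransitiveOnBlocks G × ∃ λ β → HasBlockOrbits (blockStabiliser G β) n

  TransitiveOnPairs : ∀ {m n} → Subgroup (Aut D) ℓ →
    (Automorphism D → Permutation′ m) → (Automorphism D → Permutation′ n) →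
    REL (Fin m) (Fin n) 0ℓ → Set ℓ
  TransitiveOnPairs G act₁ act₂ R = ∀ {x y x′ y′} → R x y → R x′ y′ →
    ∃ λ g → g ∈ Member G × act₁ g ⟨$⟩ʳ x ≡ x′ × act₂ g ⟨$⟩ʳ y ≡ y′

  record PairwiseTransitive (G : Subgroup (Aut D) ℓ) : Set ℓ where
    open Design D
    field
      points       : TransitiveOnPairs G onPoints onPoints _≢_
      flags        : TransitiveOnPairs G onPoints onBlocks I
      antiflags    : TransitiveOnPairs G onPoints onBlocks (λ p β → ¬ I p β)
      intersecting : TransitiveOnPairs G onBlocks onBlocks
                       (λ β γ → β ≢ γ × Intersecting D β γ)
      disjoint     : TransitiveOnPairs G onBlocks onBlocks (Disjoint D)

{-# OPTIONS --safe #-}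
-- Let N be the incidence matrix.  In rank 2, G is 2-transitive on blocks, so
-- any two distinct blocks meet in a constant number μ of points.  Evaluating
-- an entry of N Nᵀ N in two ways, at a flag and at an antiflag, gives
-- λ k = μ r and r + μ = k + λ, hence (r - k)(k - μ) = 0.  The case k = μ forces
-- r = λ and then k = v, so r = k, and v r = b k yields b = v.
-- In rank 3, the blocks other than β split into two orbits of the stabiliser
-- of β.  As G is transitive on intersecting and on disjoint pairs, exactly one
-- of them consists of blocks disjoint from β, and the intersection numbers are
-- 0 and that of the other orbit.
module Submission where

open import Defs
open import Level using (Level; 0ℓ)
open import Data.Bool.Base using (Bool; true; false; _∧_; if_then_else_)
open import Data.Empty using (⊥-elim)
open import Data.Fin.Base using (Fin; zero; suc; punchIn; opposite)
open import Data.Fin.Patterns using (0F; 1F)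
open import Data.Fin.Permutation using (_⟨$⟩ʳ_)
open import Data.Fin.Properties using (any?; ¬∀⟶∃¬; punchInᵢ≢i; punchIn-injective; nonZeroIndex)
open import Data.Nat.Base
  using (ℕ; zero; suc; _+_; _*_; _<_; z≤n; s≤s; NonZero; >-nonZero; ≢-nonZero; ≢-nonZero⁻¹)
open import Data.Nat.Properties
  using ( +-*-semiring; +-identityʳ; +-cancelˡ-≡; +-cancelʳ-≡; +-assoc; +-comm; *-identityʳ; *-zeroʳ
        ; *-cancelˡ-≡; *-cancelʳ-≡; *-distribʳ-+; m*n≡0⇒m≡0; m+n≡0⇒m≡0; ≤-total; m≤n⇒∃[o]m+o≡n
        ; <-trans; <⇒≢)
open import Data.Nat.Tactic.RingSolver using (solve-∀)
open import Data.Product.Base using (_×_; _,_; ∃; ∃₂; proj₁; proj₂)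
open import Data.Product.Function.NonDependent.Propositional using (_×-⇔_)
open import Data.Sum.Base using (_⊎_; inj₁; inj₂; [_,_]′)
open import Data.Vec.Base using (count; tabulate)
open import Function.Base using (_∘_; id)
open import Function.Bundles using (Inverse; Injection)
open import Function.Properties.Inverse using (Inverse⇒Injection)
open import Relation.Binary.Bundles using (Setoid)
open import Relation.Binary.PropositionalEquality
  using (_≡_; _≢_; refl; sym; trans; cong; cong₂; module ≡-Reasoning)
open import Relation.Nullary using (¬_; Dec; yes; no; does; contradiction)
open import Relation.Nullary.Decidable using (_×-dec_; does-⇔; dec-true; dec-false)
open import Relation.Unary using (Pred; Decidable; _∈_)
open import Algebra.Properties.Semiring.Sum +-*-semiring
  using (sum; sum-syntax; sum-cong-≗; sum-remove; ∑-comm; sum-permute; *-distribˡ-sum; *-distribʳ-sum)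

open ≡-Reasoning

sum-const : ∀ n c → ∑[ i < n ] c ≡ n * c
sum-const zero    c = refl
sum-const (suc n) c = cong (c +_) (sum-const n c)

sum≡0⇒terms≡0 : ∀ {n} (f : Fin n → ℕ) → sum f ≡ 0 → ∀ i → f i ≡ 0
sum≡0⇒terms≡0 {suc n} f eq zero    = m+n≡0⇒m≡0 (f 0F) eq
sum≡0⇒terms≡0 {suc n} f eq (suc i) =
  sum≡0⇒terms≡0 (f ∘ suc) (m+n≡0⇒m≡0 _ (trans (+-comm (sum (f ∘ suc)) (f 0F)) eq)) i

-- The term w i * c moves to the left-hand side to avoid a subtraction.
sum-constant-off : ∀ {n} (w f : Fin n → ℕ) i {c} → (∀ j → j ≢ i → f j ≡ c) →
  ∑[ j < n ] (w j * f j) + w i * c ≡ c * sum w + w i * f i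
sum-constant-off {suc n} w f i {c} off = begin
  sum (λ j → w j * f j) + w i * c
    ≡⟨ cong (_+ w i * c) (sum-remove (λ j → w j * f j)) ⟩
  w i * f i + ∑[ j < n ] (w (punchIn i j) * f (punchIn i j)) + w i * c
    ≡⟨ cong (λ s → w i * f i + s + w i * c)
         (sum-cong-≗ λ j → cong (w (punchIn i j) *_) (off _ (punchInᵢ≢i i j))) ⟩
  w i * f i + ∑[ j < n ] (w (punchIn i j) * c) + w i * c
    ≡⟨ cong (λ s → w i * f i + s + w i * c) (*-distribʳ-sum c (w ∘ punchIn i)) ⟨
  w i * f i + sum (w ∘ punchIn i) * c + w i * c
    ≡⟨ rearrangement (w i) (f i) _ c ⟩
  c * (w i + sum (w ∘ punchIn i)) + w i * f i
    ≡⟨ cong (λ s → c * s + w i * f i) (sum-remove w) ⟨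
  c * sum w + w i * f i
    ∎
  where
  rearrangement : ∀ x y s c → x * y + s * c + x * c ≡ c * (x + s) + x * y
  rearrangement = solve-∀

𝟙 : Bool → ℕ
𝟙 t = if t then 1 else 0

𝟙-∧ : ∀ s t → 𝟙 (s ∧ t) ≡ 𝟙 s * 𝟙 t
𝟙-∧ false t = refl
𝟙-∧ true  t = sym (+-identityʳ (𝟙 t))

𝟙-idem : ∀ t → 𝟙 t * 𝟙 t ≡ 𝟙 t
𝟙-idem false = refl
𝟙-idem true  = refl

count-tabulate : ∀ {A : Set} {P : Pred A 0ℓ} (P? : Decidable P) {n} (f : Fin n → A) →
  count P? (tabulate f) ≡ ∑[ i < n ] 𝟙 (does (P? (f i)))
count-tabulate P? {zero}  f = refl
count-tabulate P? {suc n} f with does (P? (f 0F))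
... | true  = cong suc (count-tabulate P? (f ∘ suc))
... | false = count-tabulate P? (f ∘ suc)

-- The hypothesis says (r - k)(k - μ) = 0.
factor-zero : ∀ r k μ → r * k + μ * k ≡ k * k + μ * r → r ≡ k ⊎ μ ≡ k
factor-zero r k μ eq with ≤-total k r
factor-zero r k μ eq | inj₁ k≤r with m≤n⇒∃[o]m+o≡n k≤r
... | zero  , refl = inj₁ (+-identityʳ k)
... | suc d , refl = inj₂ (*-cancelʳ-≡ μ k (suc d)
        (sym (+-cancelˡ-≡ (k * k + μ * k) _ _ (trans (left k (suc d) μ) (trans eq (right k (suc d) μ))))))
  where
  left : ∀ k d μ → k * k + μ * k + k * d ≡ (k + d) * k + μ * k
  left = solve-∀
  right : ∀ k d μ → k * k + μ * (k + d) ≡ k * k + μ * k + μ * d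
  right = solve-∀
factor-zero r k μ eq | inj₂ r≤k with m≤n⇒∃[o]m+o≡n r≤k
... | zero  , refl = inj₁ (sym (+-identityʳ r))
... | suc d , refl = inj₂ (*-cancelʳ-≡ μ (r + suc d) (suc d)
        (+-cancelˡ-≡ (r * (r + suc d) + μ * r) _ _ (trans (left r (suc d) μ) (trans eq (right r (suc d) μ)))))
  where
  left : ∀ r d μ → r * (r + d) + μ * r + μ * d ≡ r * (r + d) + μ * (r + d)
  left = solve-∀
  right : ∀ r d μ → (r + d) * (r + d) + μ * r ≡ r * (r + d) + μ * r + (r + d) * d
  right = solve-∀

module _ {v b : ℕ} (D : Design v b) where
  open Design D

  inc : Fin v → Fin b → ℕ
  inc p β = 𝟙 (does (I? p β))

  common-blocks : Fin v → Fin v → ℕ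
  common-blocks p q = count (λ β → I? p β ×-dec I? q β) (tabulate id)

  common-points≡∑ : ∀ β γ → common-points D β γ ≡ ∑[ p < v ] (inc p β * inc p γ)
  common-points≡∑ β γ = trans (count-tabulate (λ p → I? p β ×-dec I? p γ) id)
    (sum-cong-≗ λ p → 𝟙-∧ (does (I? p β)) _)

  common-blocks≡∑ : ∀ p q → common-blocks p q ≡ ∑[ β < b ] (inc p β * inc q β)
  common-blocks≡∑ p q = trans (count-tabulate (λ β → I? p β ×-dec I? q β) id)
    (sum-cong-≗ λ β → 𝟙-∧ (does (I? p β)) _)

  ∑-common-blocks : ∀ (w : Fin v → ℕ) p →
    ∑[ q < v ] (w q * common-blocks p q) ≡ ∑[ β < b ] (inc p β * ∑[ q < v ] (w q * inc q β))
  ∑-common-blocks w p = begin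
    ∑[ q < v ] (w q * common-blocks p q)
      ≡⟨ sum-cong-≗ (λ q → trans (cong (w q *_) (common-blocks≡∑ p q))
           (*-distribˡ-sum (w q) λ β → inc p β * inc q β)) ⟩
    ∑[ q < v ] ∑[ β < b ] (w q * (inc p β * inc q β))
      ≡⟨ ∑-comm (λ q β → w q * (inc p β * inc q β)) ⟩
    ∑[ β < b ] ∑[ q < v ] (w q * (inc p β * inc q β))
      ≡⟨ sum-cong-≗ (λ β → trans (sum-cong-≗ λ q → swap (w q) (inc p β) (inc q β))
           (sym (*-distribˡ-sum (inc p β) λ q → w q * inc q β))) ⟩
    ∑[ β < b ] (inc p β * ∑[ q < v ] (w q * inc q β))
      ∎
    where
    swap : ∀ x y z → x * (y * z) ≡ y * (x * z)
    swap = solve-∀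

  degree : Fin v → ℕ
  degree p = ∑[ β < b ] inc p β

  common-blocks-self : ∀ p → common-blocks p p ≡ degree p
  common-blocks-self p = trans (common-blocks≡∑ p p) (sum-cong-≗ λ β → 𝟙-idem (does (I? p β)))

  common-points-self : ∀ β → common-points D β β ≡ ∑[ p < v ] inc p β
  common-points-self β = trans (common-points≡∑ β β) (sum-cong-≗ λ p → 𝟙-idem (does (I? p β)))

  common-points-automorphism : (g : Automorphism D) → ∀ β γ →
    common-points D (onBlocks g ⟨$⟩ʳ β) (onBlocks g ⟨$⟩ʳ γ) ≡ common-points D β γ
  common-points-automorphism g β γ = begin
    common-points D gβ gγ
      ≡⟨ count-tabulate (λ p → I? p gβ ×-dec I? p gγ) id ⟩
    ∑[ p < v ] 𝟙 (does (I? p gβ ×-dec I? p gγ))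
      ≡⟨ sum-permute (λ p → 𝟙 (does (I? p gβ ×-dec I? p gγ))) (onPoints g) ⟩
    ∑[ p < v ] 𝟙 (does (I? (onPoints g ⟨$⟩ʳ p) gβ ×-dec I? (onPoints g ⟨$⟩ʳ p) gγ))
      ≡⟨ sum-cong-≗ (λ p → cong 𝟙 (does-⇔ (incidence g p β ×-⇔ incidence g p γ)
           (I? p β ×-dec I? p γ)
           (I? (onPoints g ⟨$⟩ʳ p) gβ ×-dec I? (onPoints g ⟨$⟩ʳ p) gγ))) ⟨
    ∑[ p < v ] 𝟙 (does (I? p β ×-dec I? p γ))
      ≡⟨ count-tabulate (λ p → I? p β ×-dec I? p γ) id ⟨
    common-points D β γ
      ∎
    where
    gβ = onBlocks g ⟨$⟩ʳ β
    gγ = onBlocks g ⟨$⟩ʳ γ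

  disjoint⇒common-points≡0 : ∀ {β γ} → Disjoint D β γ → common-points D β γ ≡ 0
  disjoint⇒common-points≡0 {β} {γ} dis = begin
    common-points D β γ
      ≡⟨ count-tabulate (λ p → I? p β ×-dec I? p γ) id ⟩
    ∑[ p < v ] 𝟙 (does (I? p β ×-dec I? p γ))
      ≡⟨ sum-cong-≗ (λ p → cong 𝟙 (dec-false (I? p β ×-dec I? p γ) (dis ∘ (p ,_)))) ⟩
    ∑[ p < v ] 0
      ≡⟨ trans (sum-const v 0) (*-zeroʳ v) ⟩
    0
      ∎

  intersecting⇒common-points≢0 : ∀ {β γ} → Intersecting D β γ → common-points D β γ ≢ 0
  intersecting⇒common-points≢0 {β} {γ} (p , i) eq = contradiction
    (trans (sym (cong 𝟙 (dec-true (I? p β ×-dec I? p γ) i)))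
      (sum≡0⇒terms≡0 _ (trans (sym (count-tabulate (λ p → I? p β ×-dec I? p γ) id)) eq) p))
    λ ()

  intersecting? : ∀ β γ → Dec (Intersecting D β γ)
  intersecting? β γ = any? λ p → I? p β ×-dec I? p γ

  module _ {k λ′ : ℕ} (is2Design : Is2Design D k λ′) where
    open Is2Design is2Design

    block-size-∑ : ∀ β → ∑[ p < v ] inc p β ≡ k
    block-size-∑ β = trans (sym (count-tabulate (λ p → I? p β) id)) (block-size β)

    common-points-self≡k : ∀ β → common-points D β β ≡ k
    common-points-self≡k β = trans (common-points-self β) (block-size-∑ β)

    incident-point : .{{NonZero k}} → ∀ β → ∃ λ p → I p β
    incident-point β with any? (λ p → I? p β)
    ... | yes p∈β = p∈β
    ... | no  ∄p  = contradiction
      (begin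
        k                   ≡⟨ block-size-∑ β ⟨
        ∑[ p < v ] inc p β  ≡⟨ sum-cong-≗ (λ p → cong 𝟙 (dec-false (I? p β) (∄p ∘ (p ,_)))) ⟩
        ∑[ p < v ] 0        ≡⟨ trans (sum-const v 0) (*-zeroʳ v) ⟩
        0                   ∎)
      (≢-nonZero⁻¹ k)

    non-incident-point : k ≢ v → ∀ β → ∃ λ p → ¬ I p β
    non-incident-point k≢v β = ¬∀⟶∃¬ v (λ p → I p β) (λ p → I? p β) λ all → k≢v (begin
      k                   ≡⟨ block-size-∑ β ⟨
      ∑[ p < v ] inc p β  ≡⟨ sum-cong-≗ (λ p → cong 𝟙 (dec-true (I? p β) (all p))) ⟩
      ∑[ p < v ] 1        ≡⟨ trans (sum-const v 1) (*-identityʳ v) ⟩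
      v                   ∎)

    total-flags : ∑[ p < v ] degree p ≡ b * k
    total-flags = begin
      ∑[ p < v ] ∑[ β < b ] inc p β  ≡⟨ ∑-comm inc ⟩
      ∑[ β < b ] ∑[ p < v ] inc p β  ≡⟨ sum-cong-≗ block-size-∑ ⟩
      ∑[ β < b ] k                   ≡⟨ sum-const b k ⟩
      b * k                          ∎

    degree-equation : ∀ p → degree p * k + λ′ ≡ λ′ * v + degree p
    degree-equation p = begin
      degree p * k + λ′
        ≡⟨ cong₂ _+_ (sym ∑-pairs) (sym (+-identityʳ λ′)) ⟩
      ∑[ q < v ] (1 * common-blocks p q) + 1 * λ′
        ≡⟨ sum-constant-off (λ _ → 1) (common-blocks p) p (λ q q≢p → pair-count (q≢p ∘ sym)) ⟩
      λ′ * ∑[ q < v ] 1 + 1 * common-blocks p p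
        ≡⟨ cong₂ (λ n r → λ′ * n + r) (trans (sum-const v 1) (*-identityʳ v))
             (trans (+-identityʳ _) (common-blocks-self p)) ⟩
      λ′ * v + degree p
        ∎
      where
      ∑-pairs : ∑[ q < v ] (1 * common-blocks p q) ≡ degree p * k
      ∑-pairs = begin
        ∑[ q < v ] (1 * common-blocks p q)
          ≡⟨ ∑-common-blocks (λ _ → 1) p ⟩
        ∑[ β < b ] (inc p β * ∑[ q < v ] (1 * inc q β))
          ≡⟨ sum-cong-≗ (λ β → cong (inc p β *_)
               (trans (sum-cong-≗ λ q → +-identityʳ (inc q β)) (block-size-∑ β))) ⟩
        ∑[ β < b ] (inc p β * k)
          ≡⟨ *-distribʳ-sum k (inc p) ⟨
        degree p * k
          ∎

    degree-constant : 1 < k → ∀ p q → degree p ≡ degree q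
    degree-constant (s≤s (s≤s {n = j} _)) p q = *-cancelʳ-≡ _ _ (suc j)
      (+-cancelʳ-≡ λ′ _ _ (trans (reduced p) (sym (reduced q))))
      where
      expand : ∀ r j l → r * j + l + r ≡ r * (1 + j) + l
      expand = solve-∀
      reduced : ∀ p → degree p * suc j + λ′ ≡ λ′ * v
      reduced p = +-cancelʳ-≡ (degree p) _ _
        (trans (expand (degree p) (suc j) λ′) (degree-equation p))

    module _ (μ : ℕ) (constant : ∀ {β γ} → β ≢ γ → common-points D β γ ≡ μ) where

      -- The entry (p , β) of N Nᵀ N.
      triple : Fin v → Fin b → ℕ
      triple p β = ∑[ γ < b ] (inc p γ * common-points D β γ)

      triple-blocks : ∀ p β → triple p β + inc p β * μ ≡ μ * degree p + inc p β * k
      triple-blocks p β = begin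
        triple p β + inc p β * μ
          ≡⟨ sum-constant-off (inc p) (common-points D β) β (λ γ γ≢β → constant (γ≢β ∘ sym)) ⟩
        μ * degree p + inc p β * common-points D β β
          ≡⟨ cong (λ n → μ * degree p + inc p β * n) (common-points-self≡k β) ⟩
        μ * degree p + inc p β * k
          ∎

      triple-points : ∀ p β → triple p β + inc p β * λ′ ≡ λ′ * k + inc p β * degree p
      triple-points p β = begin
        triple p β + inc p β * λ′
          ≡⟨ cong (_+ inc p β * λ′) (sum-cong-≗ λ γ → cong (inc p γ *_) (common-points≡∑ β γ)) ⟩
        ∑[ γ < b ] (inc p γ * ∑[ q < v ] (inc q β * inc q γ)) + inc p β * λ′
          ≡⟨ cong (_+ inc p β * λ′) (∑-common-blocks (λ q → inc q β) p) ⟨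
        ∑[ q < v ] (inc q β * common-blocks p q) + inc p β * λ′
          ≡⟨ sum-constant-off (λ q → inc q β) (common-blocks p) p (λ q q≢p → pair-count (q≢p ∘ sym)) ⟩
        λ′ * ∑[ q < v ] inc q β + inc p β * common-blocks p p
          ≡⟨ cong₂ (λ m n → λ′ * m + inc p β * n) (block-size-∑ β) (common-blocks-self p) ⟩
        λ′ * k + inc p β * degree p
          ∎

      antiflag-equation : ∀ {p β} → ¬ I p β → λ′ * k ≡ μ * degree p
      antiflag-equation {p} {β} p∉β = begin
        λ′ * k           ≡⟨ at-zero (triple-points p β) ⟨
        triple p β       ≡⟨ at-zero (triple-blocks p β) ⟩
        μ * degree p     ∎
        where
        at-zero : ∀ {t m n o} → t + inc p β * m ≡ n + inc p β * o → t ≡ n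
        at-zero {t} {m} {n} {o} eq rewrite dec-false (I? p β) p∉β =
          trans (sym (+-identityʳ t)) (trans eq (+-identityʳ n))

      flag-equation : ∀ {p β} → I p β → λ′ * k + degree p + μ ≡ μ * degree p + k + λ′
      flag-equation {p} {β} p∈β = begin
        λ′ * k + degree p + μ   ≡⟨ cong (_+ μ) (at-one (triple-points p β)) ⟨
        triple p β + λ′ + μ     ≡⟨ exchange (triple p β) λ′ μ ⟩
        triple p β + μ + λ′     ≡⟨ cong (_+ λ′) (at-one (triple-blocks p β)) ⟩
        μ * degree p + k + λ′   ∎
        where
        exchange : ∀ x y z → x + y + z ≡ x + z + y
        exchange = solve-∀
        at-one : ∀ {t m n o} → t + inc p β * m ≡ n + inc p β * o → t + m ≡ n + o
        at-one {t} {m} {n} {o} eq rewrite dec-true (I? p β) p∈β =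
          trans (cong (t +_) (sym (+-identityʳ m))) (trans eq (cong (n +_) (+-identityʳ o)))

      constant-intersection⇒symmetric : 1 < k → k ≢ v → Fin b → Symmetric D
      constant-intersection⇒symmetric 1<k k≢v β = *-cancelʳ-≡ b v k (begin
        b * k                  ≡⟨ vr≡bk ⟨
        v * r                  ≡⟨ cong (v *_) r≡k ⟩
        v * k                  ∎)
        where
        instance
          k≢0 : NonZero k
          k≢0 = >-nonZero (<-trans (s≤s z≤n) 1<k)

          b≢0 : NonZero b
          b≢0 = nonZeroIndex β

        p₀ : Fin v
        p₀ = proj₁ (non-incident-point k≢v β)

        r : ℕ
        r = degree p₀

        vr≡bk : v * r ≡ b * k
        vr≡bk = begin
          v * r                ≡⟨ sum-const v r ⟨
          ∑[ p < v ] r         ≡⟨ sum-cong-≗ (degree-constant 1<k p₀) ⟩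
          ∑[ p < v ] degree p  ≡⟨ total-flags ⟩
          b * k                ∎

        λk≡μr : λ′ * k ≡ μ * r
        λk≡μr = antiflag-equation (proj₂ (non-incident-point k≢v β))

        r+μ≡k+λ : r + μ ≡ k + λ′
        r+μ≡k+λ = +-cancelˡ-≡ (μ * r) _ _ (begin
          μ * r + (r + μ)  ≡⟨ +-assoc (μ * r) r μ ⟨
          μ * r + r + μ
            ≡⟨ cong₂ (λ x y → x + y + μ) (sym λk≡μr) (degree-constant 1<k p₀ (proj₁ flag)) ⟩
          λ′ * k + degree (proj₁ flag) + μ  ≡⟨ flag-equation (proj₂ flag) ⟩
          μ * degree (proj₁ flag) + k + λ′
            ≡⟨ cong (λ x → μ * x + k + λ′) (degree-constant 1<k (proj₁ flag) p₀) ⟩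
          μ * r + k + λ′   ≡⟨ +-assoc (μ * r) k λ′ ⟩
          μ * r + (k + λ′) ∎)
          where
          flag : ∃ λ p → I p β
          flag = incident-point β

        μ≢k : μ ≢ k
        μ≢k refl = k≢v (*-cancelˡ-≡ k v r {{r≢0}} (+-cancelʳ-≡ r _ _ (begin
          r * k + r   ≡⟨ cong (r * k +_) r≡λ ⟩
          r * k + λ′  ≡⟨ degree-equation p₀ ⟩
          λ′ * v + r  ≡⟨ cong (λ x → x * v + r) r≡λ ⟨
          r * v + r   ∎)))
          where
          r≡λ : r ≡ λ′
          r≡λ = +-cancelʳ-≡ k r λ′ (trans r+μ≡k+λ (+-comm k λ′))

          r≢0 : NonZero r
          r≢0 = ≢-nonZero λ r≡0 → ≢-nonZero⁻¹ b
            (m*n≡0⇒m≡0 b k (trans (sym vr≡bk) (trans (cong (v *_) r≡0) (*-zeroʳ v))))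

        r≡k : r ≡ k
        r≡k = [ id , (λ μ≡k → contradiction μ≡k μ≢k) ]′ (factor-zero r k μ (begin
          r * k + μ * k   ≡⟨ *-distribʳ-+ k r μ ⟨
          (r + μ) * k     ≡⟨ cong (_* k) r+μ≡k+λ ⟩
          (k + λ′) * k    ≡⟨ *-distribʳ-+ k k λ′ ⟩
          k * k + λ′ * k  ≡⟨ cong (k * k +_) λk≡μr ⟩
          k * k + μ * r   ∎))

  module _ {ℓ : Level} (G : Subgroup (Aut D) ℓ) where

    module Orbits {n} (β : Fin b) (orbits : HasBlockOrbits (blockStabiliser G β) n) where
      open Inverse orbits public using () renaming (to to orbit; from to representative)

      orbit-representative : ∀ i → orbit (representative i) ≡ i
      orbit-representative = Inverse.strictlyInverseˡ orbits

      same-orbit : ∀ {γ δ} → orbit γ ≡ orbit δ → Setoid._≈_ (blockOrbits (blockStabiliser G β)) γ δ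
      same-orbit {γ} {δ} eq = S.trans (S.sym (Inverse.inverseʳ orbits refl))
        (Inverse.inverseʳ orbits eq)
        where module S = Setoid (blockOrbits (blockStabiliser G β))

      orbit-of-base : ∀ {γ} → orbit γ ≡ orbit β → γ ≡ β
      orbit-of-base eq with same-orbit (sym eq)
      ... | g , (_ , fixes) , moves = trans (sym moves) fixes

      common-points-orbit : ∀ {γ δ} → orbit γ ≡ orbit δ → common-points D β γ ≡ common-points D β δ
      common-points-orbit eq with same-orbit eq
      ... | g , (_ , fixes) , moves = trans (sym (common-points-automorphism g β _))
        (cong₂ (common-points D) fixes moves)

    rank2-constant : BlockRank G 2 → ∃ λ μ → ∀ {β γ} → β ≢ γ → common-points D β γ ≡ μ
    rank2-constant (transitive , β , orbits) = μ , constant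
      where
      open Orbits β orbits

      other : Fin 2
      other = opposite (orbit β)

      μ : ℕ
      μ = common-points D β (representative other)

      ≢⇒opposite : ∀ {i j : Fin 2} → i ≢ j → i ≡ opposite j
      ≢⇒opposite {0F} {0F} i≢j = contradiction refl i≢j
      ≢⇒opposite {0F} {1F} _   = refl
      ≢⇒opposite {1F} {0F} _   = refl
      ≢⇒opposite {1F} {1F} i≢j = contradiction refl i≢j

      constant : ∀ {γ δ} → γ ≢ δ → common-points D γ δ ≡ μ
      constant {γ} {δ} γ≢δ with transitive γ β
      ... | g , _ , refl = trans (sym (common-points-automorphism g γ δ))
        (common-points-orbit (trans
          (≢⇒opposite (γ≢δ ∘ sym ∘ Injection.injective (Inverse⇒Injection (onBlocks g)) ∘ orbit-of-base))
          (sym (orbit-representative other))))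

    module _ (pt : PairwiseTransitive G) where
      open PairwiseTransitive pt

      intersecting-and-disjoint⇒quasisymmetric : ∀ {β γ δ} →
        β ≢ γ → Intersecting D β γ → β ≢ δ → Disjoint D β δ →
        Quasisymmetric D × (∃₂ λ β γ → β ≢ γ × Disjoint D β γ)
      intersecting-and-disjoint⇒quasisymmetric {β} {γ} {δ} β≢γ β∩γ β≢δ β∥δ =
        ( 0 , common-points D β γ , intersecting⇒common-points≢0 β∩γ ∘ sym
        , (β , δ , β≢δ , disjoint⇒common-points≡0 β∥δ)
        , (β , γ , β≢γ , refl)
        , values ) , β , δ , β≢δ , β∥δ
        where
        values : ∀ {ζ η} → ζ ≢ η → common-points D ζ η ≡ 0 ⊎ common-points D ζ η ≡ common-points D β γ
        values {ζ} {η} ζ≢η with intersecting? ζ η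
        ... | no  ζ∥η = inj₁ (disjoint⇒common-points≡0 ζ∥η)
        ... | yes ζ∩η with intersecting (β≢γ , β∩γ) (ζ≢η , ζ∩η)
        ... | g , _ , refl , refl = inj₂ (common-points-automorphism g β γ)

      rank3-quasisymmetric : BlockRank G 3 →
        Quasisymmetric D × (∃₂ λ β γ → β ≢ γ × Disjoint D β γ)
      rank3-quasisymmetric (_ , β , orbits) = split (intersecting? β γ₀) (intersecting? β γ₁)
        where
        open Orbits β orbits

        γ₀ γ₁ : Fin b
        γ₀ = representative (punchIn (orbit β) 0F)
        γ₁ = representative (punchIn (orbit β) 1F)

        β≢representative : ∀ i → β ≢ representative (punchIn (orbit β) i)
        β≢representative i eq = punchInᵢ≢i (orbit β) i
          (trans (sym (orbit-representative _)) (cong orbit (sym eq)))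

        different-orbits : ∀ {g} → g ∈ Member G →
          onBlocks g ⟨$⟩ʳ β ≡ β → onBlocks g ⟨$⟩ʳ γ₀ ≢ γ₁
        different-orbits {g} g∈G fixes moves = contradiction
          (punchIn-injective (orbit β) 0F 1F (begin
            punchIn (orbit β) 0F  ≡⟨ orbit-representative _ ⟨
            orbit γ₀              ≡⟨ Inverse.to-cong orbits (g , (g∈G , fixes) , moves) ⟩
            orbit γ₁              ≡⟨ orbit-representative _ ⟩
            punchIn (orbit β) 1F  ∎))
          λ ()

        split : Dec (Intersecting D β γ₀) → Dec (Intersecting D β γ₁) →
          Quasisymmetric D × (∃₂ λ β γ → β ≢ γ × Disjoint D β γ)
        split (yes i) (no d)  = intersecting-and-disjoint⇒quasisymmetric
          (β≢representative 0F) i (β≢representative 1F) d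
        split (no d)  (yes i) = intersecting-and-disjoint⇒quasisymmetric
          (β≢representative 1F) i (β≢representative 0F) d
        split (yes i) (yes j)
          with g , g∈G , fixes , moves ← intersecting (β≢representative 0F , i) (β≢representative 1F , j)
          = ⊥-elim (different-orbits g∈G fixes moves)
        split (no d)  (no e)
          with g , g∈G , fixes , moves ← disjoint d e
          = ⊥-elim (different-orbits g∈G fixes moves)

lemma2p4 : ∀ {ℓ : Level} (v b k λ′ : ℕ) (D : Design v b) →
    Is2Design D k λ′ → NonTrivial v k →
    (G : Subgroup (Aut D) ℓ) → PairwiseTransitive G →
    (BlockRank G 2 → Symmetric D) ×
    (BlockRank G 3 → Quasisymmetric D × (∃₂ λ β γ → β ≢ γ × Disjoint D β γ))
lemma2p4 v b k λ′ D is2Design (2<k , k<v) G pt =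
  (λ rank2@(_ , β , _) → let μ , constant = rank2-constant D G rank2 in
    constant-intersection⇒symmetric D is2Design μ constant (<-trans (s≤s (s≤s z≤n)) 2<k) (<⇒≢ k<v) β) ,
  rank3-quasisymmetric D G pt
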